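{- Suppose $T_1'$ and $T_2'$ are $n$-leaf binary trees with a common parse word. Extend each tree by attaching the $2$-leaf binary tree to leaf $i$, obtaining $T_1$ and $T_2$ respectively. Then \[|\mathrm{ParseWords}(T_1, T_2)| = 2\, |\mathrm{ParseWords}(T_1', T_2')|.\] In particular, $T_1$ and $T_2$ have a common parse word.
   Context: A binary tree is a rooted ordered tree in which each vertex has either $0$ or $2$ children; its leaves are numbered $1,2,\dots$ from left to right, and leaf $i$ denotes the $i$th leaf (the same $i$, with $1\le i\le n$, is used for both trees). Let $G$ be the context-free grammar with start symbols $0,1,2$ and rules $0\to 12$, $0\to 21$, $1\to 02$, $1\to 20$, $2\to 01$, $2\to 10$. An $n$-leaf binary tree $T$ parses a word $w$ of length $n$ on $\{0,1,2\}$ if there is a labeling of the vertices of $T$ by $0,1,2$ such that the leaves, from left to right, are labeled with the letters of $w$, and at every internal vertex the label of the vertex together with the labels of its left and right children form a rule of $G$ (i.e. the three labels are pairwise distinct). A common parse word of two $n$-leaf trees is a word parsed by both. If $T$ parses $w$, it also parses every word obtained from $w$ by permuting the alphabet $\{0,1,2\}$. For two binary trees $S_1,S_2$ with the same number of leaves, $\mathrm{ParseWords}(S_1,S_2)$ denotes the set of equivalence classes (under permutations of the alphabet $\{0,1,2\}$) of words parsed by both $S_1$ and $S_2$. Attaching the $2$-leaf binary tree to leaf $i$ means replacing leaf $i$ by an internal vertex whose two children are leaves.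
   Formalization: The equation is stated only for n ≥ 2: for n = 1 it fails, since the single-leaf trees and the 2-leaf trees obtained from them each have exactly one class of common parse words; the existence of a common parse word is stated for every n. -}

module Defs where

open import Data.Fin.Base using (Fin; splitAt)
open import Data.Fin.Patterns using (0F; 1F; 2F)
open import Data.Fin.Permutation as Perm using (Permutation′; permutation; _⟨$⟩ʳ_; _⟨$⟩ˡ_)
import Data.Fin.Properties as Fin
open import Data.List.Base as List
  using (List; []; _∷_; allFin; cartesianProduct; cartesianProductWith; concatMap; deduplicate)
open import Data.List.Membership.Propositional using (_∈_; lose)
open import Data.List.Membership.Propositional.Properties
  using (∈-allFin; ∈-map⁺; ∈-cartesianProduct⁺; ∈-cartesianProductWith⁺)
import Data.List.Membership.DecPropositional as DecMembership
import Data.List.Membership.Setoid as SetoidMembership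
open import Data.List.Membership.Setoid.Properties using (∈-lookup)
open import Data.List.Relation.Unary.All as All using (All)
open import Data.List.Relation.Unary.AllPairs using (_∷_)
open import Data.List.Relation.Unary.Any as Any using (Any; any?; here; there)
import Data.List.Relation.Unary.Any.Properties as Any
open import Data.List.Relation.Unary.Enumerates.Setoid using (IsEnumeration)
open import Data.List.Relation.Unary.Enumerates.Setoid.Properties using (deduplicate⁺)
open import Data.List.Relation.Unary.Unique.DecSetoid.Properties using (deduplicate-!)
import Data.List.Relation.Unary.Unique.Setoid as SetoidUnique
open import Data.Nat.Base using (ℕ; zero; suc; _+_)
open import Data.Nat.Properties using (+-suc)
open import Data.Product.Base using (∃; _×_; _,_; proj₁; proj₂)
open import Data.Product.Properties using (≡-dec)
open import Data.Sum.Base using (inj₁; inj₂)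
open import Data.Unit.Base using (⊤; tt)
open import Data.Vec.Base as Vec using (Vec; []; _∷_; _++_; lookup; tabulate)
open import Data.Vec.Properties as Vec using (lookup∘tabulate)
open import Function.Base using (_∘_)
open import Function.Bundles using (Inverse)
open import Level using (Level)
open import Relation.Binary.Bundles using (Setoid; DecSetoid)
open import Relation.Binary.PropositionalEquality
  using (_≡_; refl; sym; trans; cong; subst; setoid)
open import Relation.Nullary using (¬_; Dec; yes; no; contradiction)
open import Relation.Nullary.Decidable using (map′; _×-dec_)
open import Relation.Unary using (Pred; Decidable)

private
  variable
    c ℓ : Level
    m n : ℕ

------------------------------------------------------------------------
-- Trees

-- `Tree n` is the type of binary trees with n leaves; hence
-- n is positive.
data Tree : ℕ → Set where
  leaf : Tree 1
  node : Tree m → Tree n → Tree (m + n)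

-- Leaves are numbered from left to right, starting from 0F.
attachCherry : Tree n → Fin n → Tree (suc n)
attachCherry leaf _ = node leaf leaf
attachCherry (node {m} {n} l r) i with splitAt m i
... | inj₁ j = node (attachCherry l j) r
... | inj₂ j = subst Tree (+-suc m n) (node l (attachCherry r j))

------------------------------------------------------------------------
-- The grammar and parsing

Letter : Set
Letter = Fin 3

Word : ℕ → Set
Word = Vec Letter

-- (a , b , c) stands for the rule a → b c.
rules : List (Letter × Letter × Letter)
rules = (0F , 1F , 2F) ∷ (0F , 2F , 1F)
      ∷ (1F , 0F , 2F) ∷ (1F , 2F , 0F)
      ∷ (2F , 0F , 1F) ∷ (2F , 1F , 0F) ∷ []

data Labeling : Tree n → Set where
  leaf : Letter → Labeling leaf
  node : {l : Tree m} {r : Tree n} →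
         Letter → Labeling l → Labeling r → Labeling (node l r)

rootLabel : {T : Tree n} → Labeling T → Letter
rootLabel (leaf a)     = a
rootLabel (node a _ _) = a

leafWord : {T : Tree n} → Labeling T → Word n
leafWord (leaf a)     = a ∷ []
leafWord (node _ x y) = leafWord x ++ leafWord y

Valid : {T : Tree n} → Labeling T → Set
Valid (leaf _)     = ⊤
Valid (node a x y) = (a , rootLabel x , rootLabel y) ∈ rules × Valid x × Valid y

Parses : Tree n → Word n → Set
Parses T w = ∃ λ (x : Labeling T) → Valid x × leafWord x ≡ w

CommonParseWord : Tree n → Tree n → Word n → Set
CommonParseWord S₁ S₂ w = Parses S₁ w × Parses S₂ w

------------------------------------------------------------------------
-- Words up to permutations of the alphabet

infix 4 _∼_

_∼_ : Word n → Word n → Set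
u ∼ v = ∃ λ (π : Permutation′ 3) → Vec.map (π ⟨$⟩ʳ_) u ≡ v

∼-refl : {u : Word n} → u ∼ u
∼-refl = Perm.id , Vec.map-id _

∼-sym : {u v : Word n} → u ∼ v → v ∼ u
∼-sym {u = u} (π , refl) = Perm.flip π ,
  trans (sym (Vec.map-∘ _ _ u))
        (trans (Vec.map-cong (λ _ → Perm.inverseˡ π) u) (Vec.map-id u))

∼-trans : {u v w : Word n} → u ∼ v → v ∼ w → u ∼ w
∼-trans {u = u} (π , refl) (ρ , refl) = π Perm.∘ₚ ρ , Vec.map-∘ _ _ u

-- The quotient set is represented by a setoid: two elements are equal
-- when their words are equivalent, whatever the witnesses of parsing.
ParseWords : Tree n → Tree n → Setoid _ _
ParseWords S₁ S₂ = record
  { Carrier       = ∃ (CommonParseWord S₁ S₂)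
  ; _≈_           = λ x y → proj₁ x ∼ proj₁ y
  ; isEquivalence = record { refl = ∼-refl ; sym = ∼-sym ; trans = ∼-trans }
  }

------------------------------------------------------------------------
-- Finite cardinalities

HasCardinality : Setoid c ℓ → ℕ → Set _
HasCardinality S k = Inverse S (setoid (Fin k))

module _ (S : DecSetoid c ℓ) where
  open DecSetoid S renaming (setoid to Sₛ; refl to ≈-refl; sym to ≈-sym; trans to ≈-trans)
  open SetoidMembership Sₛ using () renaming (_∈_ to _∈ₛ_)
  open SetoidUnique Sₛ using (Unique)

  index-unique : ∀ {x y xs} → Unique xs → (p : x ∈ₛ xs) (q : y ∈ₛ xs) →
                 x ≈ y → Any.index p ≡ Any.index q
  index-unique _          (here _)   (here _)   _   = refl
  index-unique (z∉ ∷ _)   (here x≈z) (there q)  x≈y =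
    contradiction (≈-trans (≈-sym x≈z) x≈y) (notMember z∉ q)
    where
    notMember : ∀ {y z xs} → All (λ x → ¬ z ≈ x) xs → y ∈ₛ xs → ¬ z ≈ y
    notMember z∉ q z≈y = All.lookupWith (λ z≉x y≈x → z≉x (≈-trans z≈y y≈x)) z∉ q
  index-unique u@(_ ∷ _)  (there p)  (here y≈z) x≈y =
    sym (index-unique u (here y≈z) (there p) (≈-sym x≈y))
  index-unique (_ ∷ u)    (there p)  (there q)  x≈y =
    cong Fin.suc (index-unique u p q x≈y)

  enumeration⇒finite : ∀ {xs} → IsEnumeration Sₛ xs → ∃ (HasCardinality Sₛ)
  enumeration⇒finite {xs} enum = List.length ys , record
    { to        = λ x → Any.index (enum′ x)
    ; from      = List.lookup ys
    ; to-cong   = index-unique unique (enum′ _) (enum′ _)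
    ; from-cong = λ { refl → ≈-refl }
    ; inverse   =
        (λ {i} x≈ → trans (index-unique unique (enum′ _) (∈-lookup Sₛ ys i) x≈) (index-∈-lookup ys i))
      , (λ { refl → ≈-sym (Any.lookup-index (enum′ _)) })
    }
    where
    ys     = deduplicate _≟_ xs
    unique = deduplicate-! S xs
    enum′  = deduplicate⁺ S enum

    index-∈-lookup : ∀ zs i → Any.index (∈-lookup Sₛ zs i) ≡ i
    index-∈-lookup (_ ∷ _)  0F          = refl
    index-∈-lookup (_ ∷ zs) (Fin.suc i) = cong Fin.suc (index-∈-lookup zs i)

------------------------------------------------------------------------
-- The set of common parse words up to equivalence is finite

valid? : {T : Tree n} → Decidable (Valid {T = T})
valid? (leaf _)     = yes tt
valid? (node a x y) =
  (a , rootLabel x , rootLabel y) ∈? rules ×-dec valid? x ×-dec valid? y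
  where open DecMembership (≡-dec Fin._≟_ (≡-dec Fin._≟_ Fin._≟_)) using (_∈?_)

labelings : (T : Tree n) → List (Labeling T)
labelings leaf       = List.map leaf (allFin 3)
labelings (node l r) =
  cartesianProductWith (λ a (x , y) → node a x y) (allFin 3)
    (cartesianProduct (labelings l) (labelings r))

∈-labelings : {T : Tree n} (x : Labeling T) → x ∈ labelings T
∈-labelings (leaf a)     = ∈-map⁺ leaf (∈-allFin a)
∈-labelings (node a x y) =
  ∈-cartesianProductWith⁺ (λ a (x , y) → node a x y) (∈-allFin a)
    (∈-cartesianProduct⁺ (∈-labelings x) (∈-labelings y))

parses? : (T : Tree n) → Decidable (Parses T)
parses? T w = map′ Any.satisfied (λ (x , p) → lose (∈-labelings x) p)
  (any? (λ x → valid? x ×-dec Vec.≡-dec Fin._≟_ (leafWord x) w) (labelings T))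

∃Vec? : ∀ {k} n {P : Pred (Vec (Fin k) n) ℓ} → Decidable P → Dec (∃ P)
∃Vec? zero    P? = map′ (λ p → [] , p) (λ { ([] , p) → p }) (P? [])
∃Vec? (suc n) P? = map′ (λ (a , v , p) → a ∷ v , p) (λ { (a ∷ v , p) → a , v , p })
  (Fin.any? (λ a → ∃Vec? n (λ v → P? (a ∷ v))))

infix 4 _∼?_

_∼?_ : (u v : Word n) → Dec (u ∼ v)
u ∼? v = map′
  (λ (f , map-f , g , fg , gf) → permutation (lookup f) (lookup g) fg gf , map-f)
  (λ (π , map-π) →
      tabulate (π ⟨$⟩ʳ_)
    , trans (Vec.map-cong (lookup∘tabulate _) u) map-π
    , tabulate (π ⟨$⟩ˡ_)
    , inverse (π ⟨$⟩ʳ_) (π ⟨$⟩ˡ_) (λ _ → Perm.inverseʳ π)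
    , inverse (π ⟨$⟩ˡ_) (π ⟨$⟩ʳ_) (λ _ → Perm.inverseˡ π))
  (∃Vec? 3 λ f → Vec.≡-dec Fin._≟_ (Vec.map (lookup f) u) v ×-dec
   ∃Vec? 3 λ g → Fin.all? (λ i → lookup f (lookup g i) Fin.≟ i) ×-dec
                 Fin.all? (λ i → lookup g (lookup f i) Fin.≟ i))
  where
  inverse : (f g : Letter → Letter) → (∀ i → f (g i) ≡ i) →
            ∀ i → lookup (tabulate f) (lookup (tabulate g) i) ≡ i
  inverse f g fg i = trans (lookup∘tabulate f _) (trans (cong f (lookup∘tabulate g i)) (fg i))

ParseWords-decSetoid : Tree n → Tree n → DecSetoid _ _
ParseWords-decSetoid S₁ S₂ = record
  { Carrier          = Carrier
  ; _≈_              = _≈_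
  ; isDecEquivalence = record
    { isEquivalence = isEquivalence
    ; _≟_           = λ x y → proj₁ x ∼? proj₁ y
    }
  }
  where open Setoid (ParseWords S₁ S₂)

ParseWords-finite : (S₁ S₂ : Tree n) → ∃ (HasCardinality (ParseWords S₁ S₂))
ParseWords-finite S₁ S₂ = enumeration⇒finite (ParseWords-decSetoid S₁ S₂) complete
  where
  commonWord : Labeling S₁ → List (∃ (CommonParseWord S₁ S₂))
  commonWord x with valid? x ×-dec parses? S₂ (leafWord x)
  ... | yes (v , p) = (leafWord x , (x , v , refl) , p) ∷ []
  ... | no _        = []

  ∈-commonWord : ∀ x → Valid x → Parses S₂ (leafWord x) →
                 Any (λ y → leafWord x ∼ proj₁ y) (commonWord x)
  ∈-commonWord x v p with valid? x ×-dec parses? S₂ (leafWord x)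
  ... | yes _ = here ∼-refl
  ... | no ¬p = contradiction (v , p) ¬p

  complete : IsEnumeration (ParseWords S₁ S₂) (concatMap commonWord (labelings S₁))
  complete (_ , (x , v , refl) , p) =
    Any.concatMap⁺ commonWord (lose (∈-labelings x) (∈-commonWord x v p))

-- Well defined, as a setoid has at most one cardinality.
∣ParseWords∣ : Tree n → Tree n → ℕ
∣ParseWords∣ S₁ S₂ = proj₁ (ParseWords-finite S₁ S₂)

{-# OPTIONS --safe #-}
module Submission where

-- Splitting the letter at leaf i into the two other letters, in either order,
-- turns a common parse word of T₁′ and T₂′ into one of T₁ and T₂, and every
-- common parse word of T₁ and T₂ arises exactly once in this way.  A permutation
-- of the alphabet identifying two splittings of one word w fixes every letter
-- of w; if w has at least two letters, a node forces two distinct letters to be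
-- fixed, so the permutation is the identity and the two splittings agree.
-- Hence each class of words splits into exactly two classes.

open import Data.Fin.Base using (Fin; zero; suc; splitAt; _↑ˡ_; _↑ʳ_)
open import Data.Fin.Patterns using (0F; 1F; 2F)
open import Data.Fin.Permutation using (Permutation′; _⟨$⟩ʳ_; ↔⇒≡)
open import Data.Fin.Properties using (_≟_; all?; join-splitAt; *↔×)
open import Data.List.Membership.Propositional using (_∈_)
import Data.List.Membership.DecPropositional as DecMembership
open import Data.List.Relation.Unary.Any using (here; there)
open import Data.Nat.Base using (ℕ; suc; _+_; _*_; _≤_; s≤s)
open import Data.Nat.Properties using (+-suc)
open import Data.Product.Base using (∃; ∃₂; _×_; _,_; proj₁; proj₂)
open import Data.Product.Properties using (≡-dec; ,-injective)
open import Data.Sum.Base using (_⊎_; inj₁; inj₂)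
open import Data.Unit.Base using (tt)
open import Data.Vec.Base as Vec using ([]; _∷_; _++_)
open import Data.Vec.Properties using (∷-injective; map-++; map-cong; map-id)
open import Data.Vec.Relation.Unary.All using (All; []; _∷_)
open import Data.Vec.Relation.Unary.All.Properties using (++⁻)
open import Function.Base using (_∘_)
open import Function.Bundles using (Bijection; Inverse; Injection)
import Function.Construct.Composition as Composition
import Function.Construct.Symmetry as Symmetry
open import Function.Definitions using (Injective)
open import Function.Properties.Bijection using (Bijection⇒Inverse)
open import Function.Properties.Inverse using (Inverse⇒Injection)
open import Relation.Binary.Definitions using (DecidableEquality)
open import Relation.Binary.Bundles using (Setoid)
open import Relation.Binary.PropositionalEquality
  using (_≡_; _≢_; refl; sym; trans; cong; cong₂; subst; setoid)
open import Relation.Nullary.Decidable using (¬?; from-yes; _→-dec_; _×-dec_; _⊎-dec_)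
open import Defs

private
  variable
    m n : ℕ
    a b c : Letter

  _≟₂_ : DecidableEquality (Letter × Letter)
  _≟₂_ = ≡-dec _≟_ _≟_

  open DecMembership {A = Letter × Letter × Letter} (≡-dec _≟_ _≟₂_) using (_∈?_)

-- Rules

-- Orientation `0F` lists the two other letters in the cyclic order 0, 1, 2 that continues from the
-- split letter; `1F` lists them in reverse. The six values are the six ordered pairs of distinct
-- letters.
split : Fin 2 → Letter → Letter × Letter
split 0F 0F = 1F , 2F
split 0F 1F = 2F , 0F
split 0F 2F = 0F , 1F
split 1F 0F = 2F , 1F
split 1F 1F = 0F , 2F
split 1F 2F = 1F , 0F

rule⇒split : (a , b , c) ∈ rules → ∃ λ o → split o a ≡ (b , c)
rule⇒split (here refl)                                         = 0F , refl
rule⇒split (there (here refl))                                 = 1F , refl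
rule⇒split (there (there (here refl)))                         = 1F , refl
rule⇒split (there (there (there (here refl))))                 = 0F , refl
rule⇒split (there (there (there (there (here refl)))))         = 0F , refl
rule⇒split (there (there (there (there (there (here refl)))))) = 1F , refl

-- Abstract, since unfolding these decision procedures is very slow.
abstract
  split-rule : ∀ o a → (a , split o a) ∈ rules
  split-rule = from-yes (all? λ o → all? λ a → (a , split o a) ∈? rules)

  split-injective : ∀ o o′ a a′ → split o a ≡ split o′ a′ → o ≡ o′ × a ≡ a′
  split-injective = from-yes (all? λ o → all? λ o′ → all? λ a → all? λ a′ →
    (split o a ≟₂ split o′ a′) →-dec ((o ≟ o′) ×-dec (a ≟ a′)))

  rule⇒distinct : ∀ a b c → (a , b , c) ∈ rules → a ≢ b × a ≢ c × b ≢ c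
  rule⇒distinct = from-yes (all? λ a → all? λ b → all? λ c →
    ((a , b , c) ∈? rules) →-dec (¬? (a ≟ b) ×-dec ¬? (a ≟ c) ×-dec ¬? (b ≟ c)))

  distinct⇒rule : ∀ a b c → a ≢ b × a ≢ c × b ≢ c → (a , b , c) ∈ rules
  distinct⇒rule = from-yes (all? λ a → all? λ b → all? λ c →
    (¬? (a ≟ b) ×-dec ¬? (a ≟ c) ×-dec ¬? (b ≟ c)) →-dec ((a , b , c) ∈? rules))

  rule-exhaustive : ∀ a b c d → (a , b , c) ∈ rules → d ≡ a ⊎ d ≡ b ⊎ d ≡ c
  rule-exhaustive = from-yes (all? λ a → all? λ b → all? λ c → all? λ d →
    ((a , b , c) ∈? rules) →-dec ((d ≟ a) ⊎-dec (d ≟ b) ⊎-dec (d ≟ c)))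

  rule-functional : ∀ a a′ b c → (a , b , c) ∈ rules → (a′ , b , c) ∈ rules → a ≡ a′
  rule-functional = from-yes (all? λ a → all? λ a′ → all? λ b → all? λ c →
    ((a , b , c) ∈? rules) →-dec (((a′ , b , c) ∈? rules) →-dec (a ≟ a′)))

module _ {f : Letter → Letter} (f-inj : Injective _≡_ _≡_ f) where

  -- The rules are exactly the triples of pairwise distinct letters, and an injection keeps letters
  -- distinct.
  rule-map : (a , b , c) ∈ rules → (f a , f b , f c) ∈ rules
  rule-map r with rule⇒distinct _ _ _ r
  ... | a≢b , a≢c , b≢c = distinct⇒rule _ _ _ (a≢b ∘ f-inj , a≢c ∘ f-inj , b≢c ∘ f-inj)

  -- An odd permutation reverses the cyclic order of the letters, so the orientation may change to
  -- some `o′`.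
  split-map : ∀ o a → ∃ λ o′ → split o′ (f a) ≡ (f (proj₁ (split o a)) , f (proj₂ (split o a)))
  split-map o a = rule⇒split (rule-map (split-rule o a))

  fixes-parent : (a , b , c) ∈ rules → f b ≡ b → f c ≡ c → f a ≡ a
  fixes-parent {b = b} {c} r fb fc with rule-map r
  ... | r′ rewrite fb | fc = rule-functional _ _ b c r′ r

  fixes-children⇒id : (a , b , c) ∈ rules → f b ≡ b → f c ≡ c → ∀ d → f d ≡ d
  fixes-children⇒id {a} {b} {c} r fb fc d with rule-exhaustive a b c d r
  ... | inj₁ refl        = fixes-parent r fb fc
  ... | inj₂ (inj₁ refl) = fb
  ... | inj₂ (inj₂ refl) = fc

-- Derivations

-- The root letter is a parameter because inductions over subtrees must keep it: it is what the rule
-- one level up refers to.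
Derives : Tree n → Letter → Word n → Set
Derives leaf       a w = a ∷ [] ≡ w
Derives (node l r) a w = ∃₂ λ b c → ∃₂ λ u v →
  (a , b , c) ∈ rules × Derives l b u × Derives r c v × u ++ v ≡ w

parses⇒derives : {T : Tree n} {w : Word n} → Parses T w → ∃ λ a → Derives T a w
parses⇒derives (x , valid , refl) = rootLabel x , valid⇒derives x valid
  where
  valid⇒derives : {T : Tree m} (x : Labeling T) → Valid x → Derives T (rootLabel x) (leafWord x)
  valid⇒derives (leaf a)     _              = refl
  valid⇒derives (node a x y) (r , vx , vy) =
    _ , _ , _ , _ , r , valid⇒derives x vx , valid⇒derives y vy , refl

derives⇒parses : {w : Word n} (T : Tree n) → Derives T a w → Parses T w
derives⇒parses T D with labeling T D
  where
  labeling : {w : Word m} (T : Tree m) → Derives T a w →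
             ∃ λ (x : Labeling T) → Valid x × rootLabel x ≡ a × leafWord x ≡ w
  labeling leaf       refl                                   = leaf _ , tt , refl , refl
  labeling (node l r) (_ , _ , _ , _ , rule , D , E , refl)
    with labeling l D | labeling r E
  ... | x , vx , refl , refl | y , vy , refl , refl =
    node _ x y , (rule , vx , vy) , refl , refl
... | x , v , _ , eq = x , v , eq

derives-subst : {T : Tree m} {w : Word m} (eq : m ≡ n) →
                Derives T a w → Derives (subst Tree eq T) a (subst Word eq w)
derives-subst refl D = D

derives-subst⁻ : {T : Tree m} {w : Word n} (eq : m ≡ n) → Derives (subst Tree eq T) a w →
                 ∃ λ v → Derives T a v × subst Word eq v ≡ w
derives-subst⁻ refl D = _ , D , refl

module _ {f : Letter → Letter} (f-inj : Injective _≡_ _≡_ f) where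

  derives-map : {w : Word n} (T : Tree n) → Derives T a w → Derives T (f a) (Vec.map f w)
  derives-map leaf       refl                                 = refl
  derives-map (node l r) (_ , _ , u , v , rule , D , E , refl) =
    _ , _ , _ , _ , rule-map f-inj rule , derives-map l D , derives-map r E , sym (map-++ f u v)

  -- Induction from the leaves upwards, since the letters of two children determine that of their
  -- parent.
  fixes-root : {w : Word n} (T : Tree n) → Derives T a w → All (λ x → f x ≡ x) w → f a ≡ a
  fixes-root leaf       refl                                  (fa ∷ []) = fa
  fixes-root (node l r) (_ , _ , u , v , rule , D , E , refl) fw with ++⁻ u fw
  ... | fu , fv = fixes-parent f-inj rule (fixes-root l D fu) (fixes-root r E fv)

  -- With two leaves the root is a node. Its children carry two distinct letters, both fixed by
  -- `fixes-root`, and the third letter follows. For a single leaf, swapping the two absent letters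
  -- is a counterexample.
  fixes-word⇒id : {w : Word n} (T : Tree n) → 2 ≤ n → Derives T a w →
                  All (λ x → f x ≡ x) w → ∀ d → f d ≡ d
  fixes-word⇒id leaf       (s≤s ())
  fixes-word⇒id (node l r) _ (_ , _ , u , v , rule , D , E , refl) fw with ++⁻ u fw
  ... | fu , fv = fixes-children⇒id f-inj rule (fixes-root l D fu) (fixes-root r E fv)

map-fixed : ∀ {f : Letter → Letter} (w : Word n) → Vec.map f w ≡ w → All (λ x → f x ≡ x) w
map-fixed []      _  = []
map-fixed (x ∷ w) eq with ∷-injective eq
... | fx , fw = fx ∷ map-fixed w fw

-- Splitting a letter of a word

expand : Fin 2 → Fin n → Word n → Word (suc n)
expand o zero    (a ∷ w) = proj₁ (split o a) ∷ proj₂ (split o a) ∷ w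
expand o (suc i) (a ∷ w) = a ∷ expand o i w

-- The position `i` is known, and the two letters found there determine both the orientation and the
-- letter that was split.
expand-injective : ∀ {o o′} (i : Fin n) (w w′ : Word n) →
                   expand o i w ≡ expand o′ i w′ → o ≡ o′ × w ≡ w′
expand-injective zero (a ∷ w) (a′ ∷ w′) eq with ∷-injective eq
... | b≡b′ , eq′ with ∷-injective eq′
... | c≡c′ , w≡w′ with split-injective _ _ a a′ (cong₂ _,_ b≡b′ c≡c′)
... | o≡o′ , a≡a′ = o≡o′ , cong₂ _∷_ a≡a′ w≡w′
expand-injective (suc i) (a ∷ w) (a′ ∷ w′) eq with ∷-injective eq
... | a≡a′ , eq′ with expand-injective i w w′ eq′
... | o≡o′ , w≡w′ = o≡o′ , cong₂ _∷_ a≡a′ w≡w′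

expand-++ˡ : ∀ o (j : Fin m) (u : Word m) (v : Word n) →
             expand o (j ↑ˡ n) (u ++ v) ≡ expand o j u ++ v
expand-++ˡ o zero    (a ∷ u) v = refl
expand-++ˡ o (suc j) (a ∷ u) v = cong (a ∷_) (expand-++ˡ o j u v)

expand-++ʳ : ∀ o (j : Fin n) (u : Word m) (v : Word n) →
             expand o (m ↑ʳ j) (u ++ v) ≡ subst Word (+-suc m n) (u ++ expand o j v)
expand-++ʳ o j []      v = refl
expand-++ʳ o j (a ∷ u) v =
  trans (cong (a ∷_) (expand-++ʳ o j u v)) (∷-subst (+-suc _ _) (u ++ expand o j v))
  where
  ∷-subst : ∀ {k l} (eq : k ≡ l) (w : Word k) →
            a ∷ subst Word eq w ≡ subst Word (cong suc eq) (a ∷ w)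
  ∷-subst refl w = refl

expand-map : ∀ {f} → Injective _≡_ _≡_ f → ∀ o (i : Fin n) (w : Word n) →
             ∃ λ o′ → Vec.map f (expand o i w) ≡ expand o′ i (Vec.map f w)
expand-map f-inj o zero (a ∷ w) with split-map f-inj o a
... | o′ , eq with ,-injective eq
... | b≡ , c≡ = o′ , sym (cong₂ _∷_ b≡ (cong (_∷ _) c≡))
expand-map f-inj o (suc i) (a ∷ w) with expand-map f-inj o i w
... | o′ , eq = o′ , cong (_ ∷_) eq

-- The root of the cherry keeps the letter of the old leaf, so every rule already in the derivation
-- survives.
derives-expand : {w : Word n} (T : Tree n) (i : Fin n) (o : Fin 2) →
                 Derives T a w → Derives (attachCherry T i) a (expand o i w)
derives-expand {a = a} leaf zero o refl = _ , _ , _ , _ , split-rule o a , refl , refl , refl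
derives-expand (node {m} {n} l r) i o (b , c , u , v , rule , D , E , refl)
  -- Matching the second equation with `refl` turns `i` into `j ↑ˡ n` or `m ↑ʳ j`, the form in which
  -- `expand` passes through `++`.
  with splitAt m i | join-splitAt m n i
... | inj₁ j | refl =
  _ , _ , _ , _ , rule , derives-expand l j o D , E , sym (expand-++ˡ o j u v)
... | inj₂ j | refl =
  subst (Derives (subst Tree (+-suc m n) (node l (attachCherry r j))) _)
    (sym (expand-++ʳ o j u v))
    (derives-subst (+-suc m n) (_ , _ , _ , _ , rule , D , derives-expand r j o E , refl))

-- The rule at the cherry is a splitting of its root letter; pruning the cherry leaves that letter
-- at leaf `i`.
derives-expand⁻ : {w : Word (suc n)} (T : Tree n) (i : Fin n) → Derives (attachCherry T i) a w →
                  ∃₂ λ o v → Derives T a v × expand o i v ≡ w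
derives-expand⁻ leaf zero (_ , _ , _ , _ , rule , refl , refl , refl) with rule⇒split rule
... | o , eq = o , _ , refl , cong (λ (b , c) → b ∷ c ∷ []) eq
derives-expand⁻ (node {m} {n} l r) i D with splitAt m i | join-splitAt m n i
derives-expand⁻ (node l r) _ (_ , _ , _ , v , rule , D , E , refl) | inj₁ j | refl
  with derives-expand⁻ l j D
... | o , u , D′ , refl = o , u ++ v , (_ , _ , _ , _ , rule , D′ , E , refl) , expand-++ˡ o j u v
derives-expand⁻ (node {m} {n} l r) _ D | inj₂ j | refl with derives-subst⁻ (+-suc m n) D
... | _ , (_ , _ , u , _ , rule , D′ , E , refl) , refl with derives-expand⁻ r j E
... | o , v , E′ , refl = o , u ++ v , (_ , _ , _ , _ , rule , D′ , E′ , refl) , expand-++ʳ o j u v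

parses-expand : {w : Word n} (T : Tree n) (i : Fin n) (o : Fin 2) →
                Parses T w → Parses (attachCherry T i) (expand o i w)
parses-expand T i o p =
  derives⇒parses (attachCherry T i) (derives-expand T i o (proj₂ (parses⇒derives p)))

parses-expand⁻ : {w : Word (suc n)} (T : Tree n) (i : Fin n) → Parses (attachCherry T i) w →
                 ∃₂ λ o v → Parses T v × expand o i v ≡ w
parses-expand⁻ T i p with derives-expand⁻ T i (proj₂ (parses⇒derives p))
... | o , v , D , eq = o , v , derives⇒parses T D , eq

-- Counting classes

⟨$⟩ʳ-injective : (π : Permutation′ n) → Injective _≡_ _≡_ (π ⟨$⟩ʳ_)
⟨$⟩ʳ-injective π = Injection.injective (Inverse⇒Injection π)

module _ (T₁ T₂ : Tree n) (i : Fin n) where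

  Coarse Fine : Setoid _ _
  Coarse = ParseWords T₁ T₂
  Fine   = ParseWords (attachCherry T₁ i) (attachCherry T₂ i)

  open Setoid Coarse using () renaming (Carrier to CoarseWord)
  open Setoid Fine using () renaming (Carrier to FineWord)

  refine : Fin 2 → CoarseWord → FineWord
  refine o (w , p₁ , p₂) = expand o i w , parses-expand T₁ i o p₁ , parses-expand T₂ i o p₂

  coarsen : (y : FineWord) → ∃₂ λ o (x : CoarseWord) → expand o i (proj₁ x) ≡ proj₁ y
  coarsen (w , p₁ , p₂) with parses-expand⁻ T₁ i p₁ | parses-expand⁻ T₂ i p₂
  -- Each tree yields its own preimage of `w`. Injectivity identifies the two, so one word is parsed
  -- by both smaller trees.
  ... | o₁ , v₁ , q₁ , eq₁ | o₂ , v₂ , q₂ , eq₂ with expand-injective i v₁ v₂ (trans eq₁ (sym eq₂))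
  ... | refl , refl = o₁ , (v₁ , q₁ , q₂) , eq₁

  expand-cong-∼ : ∀ o {u v : Word n} → u ∼ v → ∃ λ o′ → expand o i u ∼ expand o′ i v
  expand-cong-∼ o {u} (π , refl) with expand-map (⟨$⟩ʳ-injective π) o i u
  ... | o′ , eq = o′ , π , eq

  expand-reflects-∼ : ∀ {o o′} {u v : Word n} → expand o i u ∼ expand o′ i v → u ∼ v
  expand-reflects-∼ {o} {u = u} {v} (π , eq) with expand-map (⟨$⟩ʳ-injective π) o i u
  ... | o″ , eq′ = π , proj₂ (expand-injective i _ v (trans (sym eq′) eq))

  -- Cancelling the expansion shows that `π` fixes `w`, hence is the identity; the two expansions
  -- are then equal as words.
  expand-orientation : ∀ {o o′} {w : Word n} → 2 ≤ n → Parses T₁ w →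
                       expand o i w ∼ expand o′ i w → o ≡ o′
  expand-orientation {o} {w = w} 2≤n p (π , eq) = proj₁ (expand-injective i w w
    (trans (sym (trans (map-cong π≗id (expand o i w)) (map-id _))) eq))
    where
    π-inj = ⟨$⟩ʳ-injective π

    π-fixes-w : Vec.map (π ⟨$⟩ʳ_) w ≡ w
    π-fixes-w with expand-map π-inj o i w
    ... | _ , eq′ = proj₂ (expand-injective i _ w (trans (sym eq′) eq))

    π≗id : ∀ d → π ⟨$⟩ʳ d ≡ d
    π≗id = fixes-word⇒id π-inj T₁ 2≤n (proj₂ (parses⇒derives p)) (map-fixed w π-fixes-w)

  module _ (2≤n : 2 ≤ n) {k} (card : HasCardinality Coarse k) where
    private module R = Inverse card

    -- Refining with a fixed orientation does not respect equivalence, as odd permutations flip the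
    -- orientation. Hence `card` first selects one representative of each coarse class.
    refinement : Bijection (setoid (Fin 2 × Fin k)) Fine
    refinement = record
      { to        = to
      ; cong      = λ { refl → ∼-refl }
      ; bijective = injective , surjective
      }
      where
      to : Fin 2 × Fin k → FineWord
      to (o , j) = refine o (R.from j)

      injective : ∀ {x y} → proj₁ (to x) ∼ proj₁ (to y) → x ≡ y
      injective {o , j} {o′ , j′} eq
        with Injection.injective (Inverse⇒Injection (Symmetry.inverse card)) {j} {j′}
               (expand-reflects-∼ eq)
      ... | refl = cong (_, j) (expand-orientation 2≤n (proj₁ (proj₂ (R.from j))) eq)

      surjective : ∀ y → ∃ λ x → ∀ {z} → z ≡ x → proj₁ (to z) ∼ proj₁ y
      surjective y with coarsen y
      -- Passing from `x` to the representative of its class may replace `o` by another orientation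
      -- `o′`.
      ... | o , x , refl with expand-cong-∼ o (∼-sym (R.strictlyInverseʳ x))
      ... | o′ , eq = (o′ , R.to x) , λ { refl → ∼-sym eq }

    refinement-cardinality : ∀ {l} → HasCardinality Fine l → 2 * k ≡ l
    refinement-cardinality card′ =
      -- The chain runs through `Fin (2 * k)`, `Fin 2 × Fin k`, `Fine` and `Fin l`.
      ↔⇒≡ (Composition.inverse *↔× (Composition.inverse (Bijection⇒Inverse refinement) card′))

proposition10 : ∀ (n : ℕ) (T₁′ T₂′ : Tree n) (i : Fin n) →
    ∃ (CommonParseWord T₁′ T₂′) →
    let T₁ = attachCherry T₁′ i
        T₂ = attachCherry T₂′ i
    in (2 ≤ n → ∣ParseWords∣ T₁ T₂ ≡ 2 * ∣ParseWords∣ T₁′ T₂′)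
       × ∃ (CommonParseWord T₁ T₂)
proposition10 n T₁′ T₂′ i w =
    (λ 2≤n → sym (refinement-cardinality T₁′ T₂′ i 2≤n
       (proj₂ (ParseWords-finite T₁′ T₂′)) (proj₂ (ParseWords-finite _ _))))
  -- Either orientation gives a common parse word.
  , refine T₁′ T₂′ i 0F w
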